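{- There is an $O(\log n)$-approximation algorithm for the $TZ_2$-optimization problem. That is, there exist a constant $C>0$ and a polynomial-time algorithm which, given any finite metric space $(V,d)$ with $|V|=n\ge 2$, outputs a set $A_1\subseteq V$ with $$cost(A_1,V,d)\le C\log n\cdot \min_{A\subseteq V}cost(A,V,d).$$
   Context: Let $(V,d)$ be a finite metric space with $n=|V|$. In the stretch-3 Thorup-Zwick distance oracle $TZ_2$, the data structure is determined by a chain $\varnothing=A_2\subseteq A_1\subseteq A_0=V$, i.e. by a set $A_1\subseteq V$. With the convention $\min_{w\in\varnothing}d(u,w)=\infty$, put $R_{iu}=\{v\in A_{i-1}\mid d(u,v)<\min_{w\in A_i}d(u,w)\}$ for $u\in V$, $i\in\{1,2\}$. The size of the data structure is $$cost(A_1,V,d)=\sum_{u\in V}\sum_{i=1}^{2}|R_{iu}|=n|A_1|+\sum_{u\in V}\left|\{v\in V\mid d(u,v)<\min_{w\in A_1}d(u,w)\}\right|.$$ The $TZ_2$-optimization problem: given $(V,d)$, find $A_1\subseteq V$ minimizing $cost(A_1,V,d)$. -}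

module Defs where

open import Algebra.Structures using (IsAbelianGroup)
open import Data.Bool using (Bool; true; false; not; if_then_else_)
open import Data.Fin using (Fin; toℕ; fromℕ<; remQuot)
open import Data.Fin.Subset using (Subset; ∣_∣; ⊤; ⊥; inside; outside)
open import Data.Fin.Subset.Properties using (_∈?_)
open import Data.List using (List; []; [_]; map; filter; allFin; _++_; _∷_)
open import Data.Nat using (ℕ; zero; suc; _+_; _*_; _∸_; _<?_; _≟_)
open import Data.Nat.ListAction using (sum)
open import Data.Product using (_×_; _,_; Σ-syntax; uncurry)
open import Data.Sum using (_⊎_)
open import Data.Vec as Vec using (tabulate)
open import Level using (0ℓ)
open import Relation.Binary using (StrictTotalOrder; IsStrictTotalOrder)
open import Relation.Binary.PropositionalEquality using (_≡_)
open import Relation.Nullary using (yes; no; does)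
open import Relation.Nullary.Decidable using (_×-dec_)
import Data.List.Extrema
import Data.List.Extrema.Nat as ExtremaNat
import Relation.Binary.Construct.Add.Supremum.Strict as Supremum
import Relation.Binary.Properties.StrictTotalOrder as STO
import Relation.Nullary.Construct.Add.Supremum as Sup

-- Distances are taken in an arbitrary linearly ordered abelian group, since
-- the real numbers are not available; (ℝ, +, <) and (ℚ, +, <) are the intended
-- instances, and a metric uses no more of ℝ than this.
record OrderedAbelianGroup : Set₁ where
  infix  4 _≈_ _≺_ _≼_
  infixl 6 _⊞_
  field
    Carrier            : Set
    _≈_ _≺_            : Carrier → Carrier → Set
    _⊞_                : Carrier → Carrier → Carrier
    0#                 : Carrier
    ⊟_                 : Carrier → Carrier
    isAbelianGroup     : IsAbelianGroup _≈_ _⊞_ 0# ⊟_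
    isStrictTotalOrder : IsStrictTotalOrder _≈_ _≺_
    ⊞-monoʳ-≺          : ∀ x {y z} → y ≺ z → x ⊞ y ≺ x ⊞ z

  _≼_ : Carrier → Carrier → Set
  x ≼ y = x ≺ y ⊎ x ≈ y

  open IsStrictTotalOrder isStrictTotalOrder public
    using () renaming (_<?_ to infix 4 _≺?_)

  strictTotalOrder⁺ : StrictTotalOrder 0ℓ 0ℓ 0ℓ
  strictTotalOrder⁺ = record
    { isStrictTotalOrder = Supremum.<⁺-isStrictTotalOrder _≺_ isStrictTotalOrder }

  -- Carrier extended by ∞ = ⊤⁺
  open StrictTotalOrder strictTotalOrder⁺ public
    using () renaming (Carrier to Carrier⁺; _<?_ to infix 4 _≺⁺?_)

  open Data.List.Extrema (STO.totalOrder strictTotalOrder⁺) public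
    using () renaming (min to min⁺)

module _ (K : OrderedAbelianGroup) where
  open OrderedAbelianGroup K

  -- A metric on the n-element set V = Fin n.
  record FiniteMetric (n : ℕ) : Set where
    field
      d        : Fin n → Fin n → Carrier
      d-nonneg : ∀ u v → 0# ≼ d u v
      d-refl   : ∀ u → d u u ≈ 0#
      d-sep    : ∀ u v → d u v ≈ 0# → u ≡ v
      d-sym    : ∀ u v → d u v ≈ d v u
      d-tri    : ∀ u v w → d u w ≼ d u v ⊞ d v w

subsets : (n : ℕ) → List (Subset n)
subsets zero    = [ Vec.[] ]
subsets (suc n) = map (inside Vec.∷_) (subsets n) ++ map (outside Vec.∷_) (subsets n)

module _ {K : OrderedAbelianGroup} {n : ℕ} (M : FiniteMetric K n) where
  open OrderedAbelianGroup K
  open FiniteMetric M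

  -- min_{w ∈ A} d(u,w), equal to ∞ for A = ∅
  minDist : Fin n → Subset n → Carrier⁺
  minDist u A = min⁺ Sup.⊤⁺ (map (λ w → Sup.[ d u w ]) (filter (_∈? A) (allFin n)))

  -- The chain A₀ = V ⊇ A₁ ⊇ A₂ = ∅ determined by A₁.
  level : Subset n → ℕ → Subset n
  level A₁ 0 = ⊤
  level A₁ 1 = A₁
  level A₁ _ = ⊥

  R : Subset n → ℕ → Fin n → Subset n
  R A₁ i u = tabulate λ v →
    does ((v ∈? level A₁ (i ∸ 1)) ×-dec (Sup.[ d u v ] ≺⁺? minDist u (level A₁ i)))

  cost : Subset n → ℕ
  cost A₁ = sum (map (λ u → sum (map (λ i → ∣ R A₁ i u ∣) (1 ∷ 2 ∷ []))) (allFin n))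

  -- The minimum of cost over all subsets; min takes a starting value, here cost ⊤.
  optimalCost : ℕ
  optimalCost = ExtremaNat.min (cost ⊤) (map cost (subsets n))

-- Model of computation: structured programs for a unit-cost random access
-- machine.  There are natural-number variables, a natural-number memory, and a
-- second memory whose cells each hold a distance; both memories are addressed
-- indirectly.  Only addition and subtraction are available, for numbers
-- and for distances alike, so on rational inputs a computation of t steps
-- handles numbers of bit length polynomial in t and in the input length.  Unit
-- cost is thus polynomially equivalent to bit cost.

infixl 7 _⊕_ _⊖_ _⊕ᵈ_ _⊖ᵈ_
infix  6 _<ᵗ_ _<ᵈ_
infixr 5 notᵗ_

data Expr : Set where
  lit     : ℕ → Expr
  var     : ℕ → Expr
  mem[_]  : Expr → Expr
  _⊕_ _⊖_ : Expr → Expr → Expr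

data DistExpr : Set where
  zeroᵈ     : DistExpr
  dist[_]   : Expr → DistExpr
  _⊕ᵈ_ _⊖ᵈ_ : DistExpr → DistExpr → DistExpr

data Test : Set where
  _<ᵗ_  : Expr → Expr → Test
  _<ᵈ_  : DistExpr → DistExpr → Test
  notᵗ_ : Test → Test

infixr 5 _⨾_
infix  6 _≔_ mem[_]≔_ dist[_]≔_

data Program : Set where
  skip           : Program
  _≔_            : ℕ → Expr → Program
  mem[_]≔_       : Expr → Expr → Program
  dist[_]≔_      : Expr → DistExpr → Program
  _⨾_            : Program → Program → Program
  ifᵖ_then_else_ : Test → Program → Program → Program
  while_loop_    : Test → Program → Program

-- Evaluating an expression or a test takes time equal to its number of nodes.
sizeᴱ : Expr → ℕ
sizeᴱ (lit _)  = 1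
sizeᴱ (var _)  = 1
sizeᴱ mem[ e ] = 1 + sizeᴱ e
sizeᴱ (e ⊕ f)  = 1 + (sizeᴱ e + sizeᴱ f)
sizeᴱ (e ⊖ f)  = 1 + (sizeᴱ e + sizeᴱ f)

sizeᴰ : DistExpr → ℕ
sizeᴰ zeroᵈ     = 1
sizeᴰ dist[ e ] = 1 + sizeᴱ e
sizeᴰ (e ⊕ᵈ f)  = 1 + (sizeᴰ e + sizeᴰ f)
sizeᴰ (e ⊖ᵈ f)  = 1 + (sizeᴰ e + sizeᴰ f)

sizeᵀ : Test → ℕ
sizeᵀ (e <ᵗ f) = 1 + (sizeᴱ e + sizeᴱ f)
sizeᵀ (e <ᵈ f) = 1 + (sizeᴰ e + sizeᴰ f)
sizeᵀ (notᵗ b) = 1 + sizeᵀ b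

_[_↦_] : {X : Set} → (ℕ → X) → ℕ → X → (ℕ → X)
(f [ i ↦ x ]) j = if does (j ≟ i) then x else f j

module _ (K : OrderedAbelianGroup) where
  open OrderedAbelianGroup K

  record State : Set where
    constructor state
    field
      vars : ℕ → ℕ
      mem  : ℕ → ℕ
      dist : ℕ → Carrier

module _ {K : OrderedAbelianGroup} where
  open OrderedAbelianGroup K
  open State

  ⟦_⟧ᴱ : Expr → State K → ℕ
  ⟦ lit k ⟧ᴱ    s = k
  ⟦ var x ⟧ᴱ    s = vars s x
  ⟦ mem[ e ] ⟧ᴱ s = mem s (⟦ e ⟧ᴱ s)
  ⟦ e ⊕ f ⟧ᴱ    s = ⟦ e ⟧ᴱ s + ⟦ f ⟧ᴱ s
  ⟦ e ⊖ f ⟧ᴱ    s = ⟦ e ⟧ᴱ s ∸ ⟦ f ⟧ᴱ s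

  ⟦_⟧ᴰ : DistExpr → State K → Carrier
  ⟦ zeroᵈ ⟧ᴰ     s = 0#
  ⟦ dist[ e ] ⟧ᴰ s = dist s (⟦ e ⟧ᴱ s)
  ⟦ e ⊕ᵈ f ⟧ᴰ    s = ⟦ e ⟧ᴰ s ⊞ ⟦ f ⟧ᴰ s
  ⟦ e ⊖ᵈ f ⟧ᴰ    s = ⟦ e ⟧ᴰ s ⊞ (⊟ ⟦ f ⟧ᴰ s)

  ⟦_⟧ᵀ : Test → State K → Bool
  ⟦ e <ᵗ f ⟧ᵀ s = does (⟦ e ⟧ᴱ s <? ⟦ f ⟧ᴱ s)
  ⟦ e <ᵈ f ⟧ᵀ s = does (⟦ e ⟧ᴰ s ≺? ⟦ f ⟧ᴰ s)
  ⟦ notᵗ b ⟧ᵀ s = not (⟦ b ⟧ᵀ s)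

  -- ⟨ P , s ⟩⇓[ t ] s′ : started in s, the program P halts after exactly t time
  -- units in s′.
  infix 4 ⟨_,_⟩⇓[_]_

  data ⟨_,_⟩⇓[_]_ : Program → State K → ℕ → State K → Set where
    ⇓-skip : ∀ {s} → ⟨ skip , s ⟩⇓[ 1 ] s

    ⇓-var : ∀ {x e s} →
      ⟨ x ≔ e , s ⟩⇓[ 1 + sizeᴱ e ]
        state (vars s [ x ↦ ⟦ e ⟧ᴱ s ]) (mem s) (dist s)

    ⇓-mem : ∀ {a e s} →
      ⟨ mem[ a ]≔ e , s ⟩⇓[ 1 + (sizeᴱ a + sizeᴱ e) ]
        state (vars s) (mem s [ ⟦ a ⟧ᴱ s ↦ ⟦ e ⟧ᴱ s ]) (dist s)

    ⇓-dist : ∀ {a e s} →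
      ⟨ dist[ a ]≔ e , s ⟩⇓[ 1 + (sizeᴱ a + sizeᴰ e) ]
        state (vars s) (mem s) (dist s [ ⟦ a ⟧ᴱ s ↦ ⟦ e ⟧ᴰ s ])

    ⇓-seq : ∀ {P Q s s′ s″ t t′} →
      ⟨ P , s ⟩⇓[ t ] s′ → ⟨ Q , s′ ⟩⇓[ t′ ] s″ →
      ⟨ P ⨾ Q , s ⟩⇓[ t + t′ ] s″

    ⇓-then : ∀ {b P Q s s′ t} → ⟦ b ⟧ᵀ s ≡ true →
      ⟨ P , s ⟩⇓[ t ] s′ →
      ⟨ ifᵖ b then P else Q , s ⟩⇓[ sizeᵀ b + t ] s′

    ⇓-else : ∀ {b P Q s s′ t} → ⟦ b ⟧ᵀ s ≡ false →
      ⟨ Q , s ⟩⇓[ t ] s′ →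
      ⟨ ifᵖ b then P else Q , s ⟩⇓[ sizeᵀ b + t ] s′

    ⇓-stop : ∀ {b P s} → ⟦ b ⟧ᵀ s ≡ false →
      ⟨ while b loop P , s ⟩⇓[ sizeᵀ b ] s

    ⇓-loop : ∀ {b P s s′ s″ t t′} → ⟦ b ⟧ᵀ s ≡ true →
      ⟨ P , s ⟩⇓[ t ] s′ → ⟨ while b loop P , s′ ⟩⇓[ t′ ] s″ →
      ⟨ while b loop P , s ⟩⇓[ sizeᵀ b + (t + t′) ] s″

  module _ {n : ℕ} (M : FiniteMetric K n) where
    open FiniteMetric M

    -- Row-major: d(u,v) is stored in cell n * u + v; all other cells are 0.
    inputDist : ℕ → Carrier
    inputDist a with a <? n * n
    ... | yes a<n² = uncurry d (remQuot n (fromℕ< a<n²))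
    ... | no  _    = 0#

    -- Variable 0 holds n; all other variables and the memory are 0.
    initial : State K
    initial = state ((λ _ → 0) [ 0 ↦ n ]) (λ _ → 0) inputDist

  -- The output is { v | memory cell v is nonzero }.
  output : (n : ℕ) → State K → Subset n
  output n s = tabulate λ v → does (0 <? mem s (toℕ v))

  _On_Outputs_After_ : {n : ℕ} → Program → FiniteMetric K n → Subset n → ℕ → Set
  _On_Outputs_After_ {n} P M A t =
    Σ[ s ∈ State K ] (⟨ P , initial M ⟩⇓[ t ] s × output n s ≡ A)

{-# OPTIONS --safe #-}
module Submission where

open import Defs
open import Data.Bool using (Bool; true; false; _∨_; _∧_; if_then_else_)
open import Data.Bool.Properties using (∨-zeroʳ; ∨-identityʳ; ∧-identityʳ)
open import Data.Empty using (⊥-elim)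
open import Data.Fin using (Fin; zero; suc; toℕ; fromℕ<; inject₁; combine; remQuot)
import Data.Fin.Properties as Fin
open import Data.Fin.Subset using (Subset; ∣_∣; ⊤; ⊥; _∈_)
open import Data.Fin.Subset.Properties using (_∈?_; ∈⊤; ∉⊥)
open import Data.List as List using (map; allFin)
import Data.List.Extrema as Extrema
import Data.List.Extrema.Nat as ExtremaNat
open import Data.List.Membership.Propositional.Properties
  using (∈-map⁺; ∈-map⁻; ∈-filter⁺; ∈-filter⁻; ∈-allFin)
open import Data.List.Relation.Unary.All as All using (All)
import Data.List.Relation.Unary.All.Properties as All
open import Data.Nat using
  (ℕ; zero; suc; _+_; _*_; _∸_; _^_; _≤_; _<_; _<?_; _≤?_; _≟_; z≤n; s≤s; s≤s⁻¹; >-nonZero)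
import Data.Nat.ListAction as ListAction
open import Data.Nat.Logarithm using (⌊log₂_⌋; ⌊log₂⌋-mono-≤; ⌊log₂[2^n]⌋≡n)
open import Data.Nat.Properties hiding (_≟_; _<?_; _≤?_)
open import Data.Nat.Tactic.RingSolver using (solve-∀)
open import Data.Product using (_×_; Σ-syntax; _,_; ∃; proj₁; proj₂; uncurry)
open import Data.Sum using (_⊎_; inj₁; inj₂; [_,_]′)
open import Data.Vec using (tabulate; lookup)
open import Data.Vec.Properties using ([]=⇒lookup; lookup⇒[]=; lookup∘tabulate; tabulate∘lookup)
open import Function using (_∘_; id)
open import Relation.Binary using (StrictTotalOrder)
import Relation.Binary.Construct.Add.Supremum.Strict as Supremum
import Relation.Binary.Properties.StrictTotalOrder as STO
open import Relation.Binary.PropositionalEquality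
open import Relation.Nullary using (Dec; yes; no; does; ¬_)
open import Relation.Nullary.Decidable
  using (dec-true; dec-false; _×-dec_; True; toWitness; fromWitness)
import Relation.Nullary.Construct.Add.Supremum as Sup

open import Algebra.Properties.Semiring.Sum +-*-semiring
  using ( sum; sum-syntax; sum-cong-≗; sum-replicate-zero; sum-init-last
        ; ∑-comm; ∑-distrib-+; *-distribˡ-sum; *-distribʳ-sum)

-- TZ₂-optimization is a partial covering problem on the pairs (u,v): a vertex w
-- covers (u,v) unless d(u,v) < d(u,w), and cost(A) is n |A| plus the number of
-- pairs (the residue) that no w ∈ A covers.  The greedy algorithm adds the vertex
-- that covers most new pairs as long as their number exceeds the price n.
-- Against an optimal set ω of size k and residue F, averaging over ω shows that
-- the best vertex reduces the excess of the residue over F by a k-th of it.  So k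
-- rounds halve the excess, and after 1 + ⌊log₂ n⌋ such blocks it has dropped from
-- n² to at most n.  If the algorithm stops earlier, then every vertex of ω gains
-- at most n, so that the excess is at most n k.  Later rounds only lower the cost.

-- Finite sums and the binary logarithm.

sum-mono-≤ : ∀ {n} {f g : Fin n → ℕ} → (∀ i → f i ≤ g i) → sum f ≤ sum g
sum-mono-≤ {zero}  f≤g = z≤n
sum-mono-≤ {suc n} f≤g = +-mono-≤ (f≤g zero) (sum-mono-≤ (f≤g ∘ suc))

sum-mono-< : ∀ {n} {f g : Fin n → ℕ} → (∀ i → f i ≤ g i) → ∀ j → f j < g j → sum f < sum g
sum-mono-< f≤g zero    f<g = +-mono-<-≤ f<g (sum-mono-≤ (f≤g ∘ suc))
sum-mono-< f≤g (suc j) f<g = +-mono-≤-< (f≤g zero) (sum-mono-< (f≤g ∘ suc) j f<g)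

sum-bound : ∀ {n} {f : Fin n → ℕ} {b} → (∀ i → f i ≤ b) → sum f ≤ n * b
sum-bound {zero}  f≤b = z≤n
sum-bound {suc n} f≤b = +-mono-≤ (f≤b zero) (sum-bound (f≤b ∘ suc))

term≤sum : ∀ {n} (f : Fin n → ℕ) i → f i ≤ sum f
term≤sum f zero    = m≤m+n _ _
term≤sum f (suc i) = ≤-trans (term≤sum (f ∘ suc) i) (m≤n+m _ _)

sum-zero : ∀ {n} {f : Fin n → ℕ} → (∀ i → f i ≡ 0) → sum f ≡ 0
sum-zero {n} f≡0 = trans (sum-cong-≗ f≡0) (sum-replicate-zero n)

sum>0⇒∃>0 : ∀ {n} (f : Fin n → ℕ) → 0 < sum f → ∃ λ i → 0 < f i
sum>0⇒∃>0 {suc n} f 0<Σ with f zero in eq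
... | suc _ = zero , subst (0 <_) (sym eq) (s≤s z≤n)
... | zero  with sum>0⇒∃>0 (f ∘ suc) 0<Σ
...   | i , 0<fi = suc i , 0<fi

sum-const : ∀ n c → ∑[ i < n ] c ≡ n * c
sum-const zero    c = refl
sum-const (suc n) c = cong (c +_) (sum-const n c)

sum-adjust-≤ : ∀ {n} {f g : Fin n → ℕ} j →
  (∀ i → i ≢ j → f i ≤ g i) → f j ≤ suc (g j) → sum f ≤ suc (sum g)
sum-adjust-≤ zero    f≤g fj≤ = +-mono-≤ fj≤ (sum-mono-≤ λ i → f≤g (suc i) λ ())
sum-adjust-≤ {f = f} {g} (suc j) f≤g fj≤ = ≤-trans
  (+-mono-≤ (f≤g zero λ ()) (sum-adjust-≤ j (λ i i≢j → f≤g (suc i) (i≢j ∘ Fin.suc-injective)) fj≤))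
  (≤-reflexive (+-suc (g zero) _))

sum-list : ∀ {A : Set} {n} (g : A → ℕ) (h : Fin n → A) →
  ListAction.sum (map g (List.tabulate h)) ≡ ∑[ i < n ] g (h i)
sum-list {n = zero}  g h = refl
sum-list {n = suc n} g h = cong (g (h zero) +_) (sum-list g (h ∘ suc))

-- Partial sums serve as loop invariants: after `i` iterations an accumulator holds `Σ< i g`, and at
-- `i = n` this is the sum over `Fin n` by definition.
Σ< : ℕ → (ℕ → ℕ) → ℕ
Σ< i g = ∑[ j < i ] g (toℕ j)

Σ<-suc : ∀ i g → Σ< (suc i) g ≡ Σ< i g + g i
Σ<-suc i g = trans (sum-init-last {i} (g ∘ toℕ))
  (cong₂ _+_ (sum-cong-≗ {i} {λ j → g (toℕ (inject₁ j))} {g ∘ toℕ} (cong g ∘ Fin.toℕ-inject₁))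
             (cong g (Fin.toℕ-fromℕ i)))

-- Otherwise monotonicity of `⌊log₂_⌋` would give `suc ⌊log₂ n ⌋ ≤ ⌊log₂ n ⌋`.
n<2^[1+⌊log₂n⌋] : ∀ n → n < 2 ^ suc ⌊log₂ n ⌋
n<2^[1+⌊log₂n⌋] n = ≰⇒> λ 2^≤n → <-irrefl refl
  (subst (_≤ ⌊log₂ n ⌋) (⌊log₂[2^n]⌋≡n (suc ⌊log₂ n ⌋)) (⌊log₂⌋-mono-≤ 2^≤n))

-- Greedy partial covering

bit : Bool → ℕ
bit b = if b then 1 else 0

bit≤1 : ∀ b → bit b ≤ 1
bit≤1 true  = ≤-refl
bit≤1 false = z≤n

module Greedy {n : ℕ} (covers : Fin n → Fin n → Fin n → ℕ) where

  -- Truncated subtraction makes `uncovered` the 0/1 indicator of `hits` being zero; the program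
  -- computes it in the same way.
  hits uncovered : (Fin n → Bool) → Fin n → Fin n → ℕ
  hits χ u v = ∑[ w < n ] (bit (χ w) * covers u v w)
  uncovered χ u v = 1 ∸ hits χ u v

  size residue : (Fin n → Bool) → ℕ
  size χ = ∑[ w < n ] bit (χ w)
  residue χ = ∑[ u < n ] ∑[ v < n ] uncovered χ u v

  adjoin : (Fin n → Bool) → Fin n → (Fin n → Bool)
  adjoin χ c w = χ w ∨ does (w Fin.≟ c)

  bit-adjoin : ∀ χ c w → bit (χ w) ≤ bit (adjoin χ c w)
  bit-adjoin χ c w with χ w
  ... | true  = ≤-refl
  ... | false = z≤n

  adjoin-self : ∀ χ c → adjoin χ c c ≡ true
  adjoin-self χ c rewrite dec-true (c Fin.≟ c) refl with χ c
  ... | true  = refl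
  ... | false = refl

  uncovered-adjoin-≤ : ∀ χ c u v → uncovered (adjoin χ c) u v ≤ uncovered χ u v
  uncovered-adjoin-≤ χ c u v =
    ∸-monoʳ-≤ 1 (sum-mono-≤ λ w → *-monoˡ-≤ (covers u v w) (bit-adjoin χ c w))

  uncovered-adjoin≡0 : ∀ χ c u v → 0 < covers u v c → uncovered (adjoin χ c) u v ≡ 0
  uncovered-adjoin≡0 χ c u v 0<cov = m≤n⇒m∸n≡0 (≤-trans 0<cov (begin
    covers u v c                        ≡⟨ sym (*-identityˡ _) ⟩
    1 * covers u v c                    ≡⟨ cong (λ b → bit b * covers u v c) (sym (adjoin-self χ c)) ⟩
    bit (adjoin χ c c) * covers u v c   ≤⟨ term≤sum (λ w → bit (adjoin χ c w) * covers u v w) c ⟩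
    hits (adjoin χ c) u v               ∎))
    where open ≤-Reasoning

  residue-cong : ∀ {χ ψ} → (∀ w → χ w ≡ ψ w) → residue χ ≡ residue ψ
  residue-cong eq = sum-cong-≗ λ u → sum-cong-≗ λ v → cong (1 ∸_)
    (sum-cong-≗ λ w → cong (λ b → bit b * covers u v w) (eq w))

  size-cong : ∀ {χ ψ} → (∀ w → χ w ≡ ψ w) → size χ ≡ size ψ
  size-cong eq = sum-cong-≗ (cong bit ∘ eq)

  residue≤n² : ∀ χ → residue χ ≤ n * n
  residue≤n² χ = sum-bound λ u →
    ≤-trans (sum-bound λ v → m∸n≤m 1 (hits χ u v)) (≤-reflexive (*-identityʳ n))

  -- A set without elements covers nothing, so each pair contributes 1. This settles the case of an
  -- empty competitor, over which no average can be taken.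
  residue-max : ∀ ψ χ → size ψ ≡ 0 → residue χ ≤ residue ψ
  residue-max ψ χ size≡0 = sum-mono-≤ λ u → sum-mono-≤ λ v →
    ≤-trans (m∸n≤m 1 (hits χ u v)) (≤-reflexive (cong (1 ∸_) (sym (hits≡0 u v))))
    where
    bit≡0 : ∀ w → bit (ψ w) ≡ 0
    bit≡0 w = n≤0⇒n≡0 (≤-trans (term≤sum (bit ∘ ψ) w) (≤-reflexive size≡0))
    hits≡0 : ∀ u v → hits ψ u v ≡ 0
    hits≡0 u v = sum-zero λ w → cong (_* covers u v w) (bit≡0 w)

  -- Averaging over a competing set.

  weighted≤ : ∀ (χ ω : Fin n → Bool) u v o → bit (ω o) * uncovered (adjoin χ o) u v ≤ bit (ω o)
  weighted≤ χ ω u v o =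
    ≤-trans (*-monoʳ-≤ (bit (ω o)) (m∸n≤m 1 (hits (adjoin χ o) u v))) (≤-reflexive (*-identityʳ _))

  -- Subtractions moved across, this says: if `ω` covers the pair and `χ` does not, then adjoining
  -- some `o` in `ω` to `χ` covers it. If `χ` covers the pair, the left side is 0; if neither does,
  -- both sides have the summand 1 and the rest is termwise.
  averaging-pointwise : ∀ χ ω u v →
    uncovered χ u v + ∑[ o < n ] (bit (ω o) * uncovered (adjoin χ o) u v)
      ≤ uncovered ω u v + size ω * uncovered χ u v
  averaging-pointwise χ ω u v with hits χ u v in hχ | hits ω u v in hω
  ... | suc h | _ = ≤-trans (≤-reflexive (cong₂ _+_ (0∸n≡0 h)
    (sum-zero λ o → trans (cong (bit (ω o) *_) (≡0 o)) (*-zeroʳ (bit (ω o)))))) z≤n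
    where
    ≡0 : ∀ o → uncovered (adjoin χ o) u v ≡ 0
    ≡0 o = n≤0⇒n≡0 (≤-trans (uncovered-adjoin-≤ χ o u v) (≤-trans (≤-reflexive (cong (1 ∸_) hχ)) (m∸n≤m 0 h)))
  ... | zero | zero =
    s≤s (≤-trans (sum-mono-≤ (weighted≤ χ ω u v)) (≤-reflexive (sym (*-identityʳ _))))
  ... | zero | suc h with sum>0⇒∃>0 (λ w → bit (ω w) * covers u v w) (subst (0 <_) (sym hω) (s≤s z≤n))
  ...   | o , 0<o = ≤-trans (sum-mono-< (weighted≤ χ ω u v) o (weighted< 0<o))
      (≤-trans (≤-reflexive (sym (*-identityʳ _))) (m≤n+m _ (0 ∸ h)))
    where
    weighted< : 0 < bit (ω o) * covers u v o → bit (ω o) * uncovered (adjoin χ o) u v < bit (ω o)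
    weighted< p with ω o
    ... | true = subst (λ x → 1 * x < 1)
      (sym (uncovered-adjoin≡0 χ o u v (subst (0 <_) (*-identityˡ _) p))) (s≤s z≤n)

  -- The pointwise inequality is summed over all pairs and the sum over `o` moved outside. In
  -- subtractive form, `residue χ - residue ω ≤ size ω * (residue χ - b)`: the best vertex removes
  -- at least the share `1 / size ω` of the excess.
  averaging : ∀ χ ω b → (∀ c → b ≤ residue (adjoin χ c)) →
    residue χ + size ω * b ≤ residue ω + size ω * residue χ
  averaging χ ω b b≤ = begin
    residue χ + size ω * b
      ≡⟨ cong (residue χ +_) (*-distribʳ-sum b (bit ∘ ω)) ⟩
    residue χ + ∑[ o < n ] (bit (ω o) * b)
      ≤⟨ +-monoʳ-≤ (residue χ) (sum-mono-≤ λ o → *-monoʳ-≤ (bit (ω o)) (b≤ o)) ⟩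
    residue χ + ∑[ o < n ] (bit (ω o) * residue (adjoin χ o))
      ≡⟨ cong (residue χ +_) (sum-cong-≗ λ o → trans
           (*-distribˡ-sum (bit (ω o)) (λ u → ∑[ v < n ] uncovered (adjoin χ o) u v))
           (sum-cong-≗ λ u → *-distribˡ-sum (bit (ω o)) (uncovered (adjoin χ o) u))) ⟩
    residue χ + ∑[ o < n ] ∑[ u < n ] ∑[ v < n ] term u v o
      ≡⟨ cong (residue χ +_) (trans (∑-comm (λ o u → ∑[ v < n ] term u v o))
           (sum-cong-≗ λ u → ∑-comm (λ o v → term u v o))) ⟩
    residue χ + ∑[ u < n ] ∑[ v < n ] ∑[ o < n ] term u v o
      ≡⟨ ∑∑-distrib-+ (uncovered χ) _ ⟩
    ∑[ u < n ] ∑[ v < n ] (uncovered χ u v + ∑[ o < n ] term u v o)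
      ≤⟨ sum-mono-≤ (λ u → sum-mono-≤ λ v → averaging-pointwise χ ω u v) ⟩
    ∑[ u < n ] ∑[ v < n ] (uncovered ω u v + size ω * uncovered χ u v)
      ≡⟨ sym (∑∑-distrib-+ (uncovered ω) _) ⟩
    residue ω + ∑[ u < n ] ∑[ v < n ] (size ω * uncovered χ u v)
      ≡⟨ cong (residue ω +_) (sym (trans
           (*-distribˡ-sum (size ω) (λ u → ∑[ v < n ] uncovered χ u v))
           (sum-cong-≗ λ u → *-distribˡ-sum (size ω) (uncovered χ u)))) ⟩
    residue ω + size ω * residue χ ∎
    where
    open ≤-Reasoning
    term : Fin n → Fin n → Fin n → ℕ
    term u v o = bit (ω o) * uncovered (adjoin χ o) u v
    ∑∑-distrib-+ : ∀ (f g : Fin n → Fin n → ℕ) →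
      ∑[ u < n ] ∑[ v < n ] f u v + ∑[ u < n ] ∑[ v < n ] g u v
        ≡ ∑[ u < n ] ∑[ v < n ] (f u v + g u v)
    ∑∑-distrib-+ f g = trans (sym (∑-distrib-+ (λ u → sum (f u)) (λ u → sum (g u))))
      (sum-cong-≗ λ u → sym (∑-distrib-+ (f u) (g u)))

  -- The program always makes `n` rounds, so a round that finds no worthwhile vertex is a step as
  -- well. The drop by more than `n` in `advance` both pays for the new vertex and limits the number
  -- of advances.
  data Step (χ χ′ : Fin n → Bool) : Set where
    halt    : size χ′ ≤ size χ → residue χ′ ≤ residue χ →
              (∀ c → residue χ ≤ n + residue (adjoin χ c)) → Step χ χ′
    advance : size χ′ ≤ suc (size χ) → n + residue χ′ < residue χ →
              (∀ c → residue χ′ ≤ residue (adjoin χ c)) → Step χ χ′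

  -- Decay of the excess in blocks of rounds.

  module Analysis (ω : Fin n → Bool) (L : ℕ)
    (1≤L : 1 ≤ L) (n<2^[1+L] : n < 2 ^ suc L) (0<n : 0 < n) where

    k F : ℕ
    k = size ω
    F = residue ω

    Good : (Fin n → Bool) → Set
    Good χ = n * size χ + residue χ ≤ 3 * L * (n * k + F)

    -- A round never raises the cost: an advance pays at most `n` for one vertex and saves more than
    -- `n` on the residue.
    good-step : ∀ {χ χ′} → Step χ χ′ → Good χ → Good χ′
    good-step (halt s≤ r≤ _) = ≤-trans (+-mono-≤ (*-monoʳ-≤ n s≤) r≤)
    good-step {χ} {χ′} (advance s≤ r< _) = ≤-trans (begin
      n * size χ′ + residue χ′        ≤⟨ +-monoˡ-≤ (residue χ′) (*-monoʳ-≤ n s≤) ⟩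
      n * suc (size χ) + residue χ′   ≡⟨ eq n (size χ) (residue χ′) ⟩
      n * size χ + (n + residue χ′)   ≤⟨ +-monoʳ-≤ (n * size χ) (<⇒≤ r<) ⟩
      n * size χ + residue χ          ∎)
      where
      open ≤-Reasoning
      eq : ∀ n s r → n * suc s + r ≡ n * s + (n + r)
      eq = solve-∀

    -- The cost is at most `(L + 2) * (n * k) + F`, and `L + 2 ≤ 3 * L` since `1 ≤ L`. This is the
    -- origin of the constant 3; the last bracket in `eq` is the slack.
    good-if : ∀ {χ} → size χ ≤ suc L * k → residue χ ≤ F + n * k → Good χ
    good-if s≤ r≤ = ≤-trans (+-mono-≤ (*-monoʳ-≤ n s≤) r≤) (bound L 1≤L)
      where
      eq : ∀ n k F L → 3 * suc L * (n * k + F)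
        ≡ n * (suc (suc L) * k) + (F + n * k) + (2 * L * (n * k) + 3 * L * F + 2 * F)
      eq = solve-∀
      bound : ∀ L → 1 ≤ L → n * (suc L * k) + (F + n * k) ≤ 3 * L * (n * k + F)
      bound (suc L) _ = ≤-trans (m≤m+n _ _) (≤-reflexive (sym (eq n k F L)))

    -- If no vertex gains more than `n`, then `r ∸ n` bounds every next residue from below.
    -- Averaging with this bound yields `r ≤ F + n * k`; truncation is harmless because
    -- `r ≤ n + (r ∸ n)` always holds.
    good-halted : ∀ {χ} → size χ ≤ suc L * k → (∀ c → residue χ ≤ n + residue (adjoin χ c)) → Good χ
    good-halted {χ} s≤ stuck = good-if s≤ (+-cancelʳ-≤ (k * r) _ _ (begin
      r + k * r                  ≤⟨ +-monoʳ-≤ r (*-monoʳ-≤ k (m≤n+m∸n r n)) ⟩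
      r + k * (n + (r ∸ n))      ≡⟨ eq r k n (r ∸ n) ⟩
      r + k * (r ∸ n) + n * k    ≤⟨ +-monoˡ-≤ (n * k) 
        (averaging χ ω (r ∸ n) λ c → m≤n+o⇒m∸n≤o r n (stuck c)) ⟩
      F + k * r + n * k          ≡⟨ eq′ F (k * r) (n * k) ⟩
      F + n * k + k * r          ∎))
      where
      open ≤-Reasoning
      r = residue χ
      eq : ∀ r k n x → r + k * (n + x) ≡ r + k * x + n * k
      eq = solve-∀
      eq′ : ∀ a b c → a + b + c ≡ a + c + b
      eq′ = solve-∀

    -- base is the residue at the beginning of the current block of k rounds, of which
    -- pos have been made.
    record Climbing (t : ℕ) (χ : Fin n → Bool) : Set where
      field
        block pos base : ℕ
        block≤L  : block ≤ L
        pos<k    : pos < k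
        size≤    : size χ ≤ block * k + pos
        base≤    : 2 ^ block * base ≤ 2 ^ block * F + n * n
        residue≤ : (k + pos) * residue χ ≤ pos * F + k * base
        steps≤   : residue χ + t * suc n ≤ n * n

    Phase : ℕ → (Fin n → Bool) → Set
    Phase t χ = Good χ ⊎ Climbing t χ

    -- After `k` rounds the bound within the block reads `2 * r ≤ F + B`, so the excess over `F` is
    -- at most half of that of `B`.
    block-end : ∀ j B r → 0 < k → 2 ^ j * B ≤ 2 ^ j * F + n * n →
      (k + k) * r ≤ k * F + k * B → 2 ^ suc j * r ≤ 2 ^ suc j * F + n * n
    block-end j B r 0<k B≤ r≤ = begin
      2 ^ suc j * r                          ≡⟨ eq₁ (2 ^ j) r ⟩
      2 ^ j * (2 * r)                        ≤⟨ *-monoʳ-≤ (2 ^ j) 2r≤ ⟩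
      2 ^ j * (F + B)                        ≡⟨ *-distribˡ-+ (2 ^ j) F B ⟩
      2 ^ j * F + 2 ^ j * B                  ≤⟨ +-monoʳ-≤ (2 ^ j * F) B≤ ⟩
      2 ^ j * F + (2 ^ j * F + n * n)        ≡⟨ eq₂ (2 ^ j) F (n * n) ⟩
      2 ^ suc j * F + n * n                  ∎
      where
      open ≤-Reasoning
      eq₁ : ∀ p r → 2 * p * r ≡ p * (2 * r)
      eq₁ = solve-∀
      eq₂ : ∀ p F N → p * F + (p * F + N) ≡ 2 * p * F + N
      eq₂ = solve-∀
      eq₃ : ∀ k r → k * (2 * r) ≡ (k + k) * r
      eq₃ = solve-∀
      2r≤ : 2 * r ≤ F + B
      2r≤ = *-cancelˡ-≤ k {{>-nonZero 0<k}} 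
        (≤-trans (≤-reflexive (eq₃ k r)) (≤-trans r≤ (≤-reflexive (sym (*-distribˡ-+ k F B)))))

    -- The remaining excess is at most `n * n` divided by `2 ^ suc L`, which exceeds `n`.
    last-block-end : ∀ r → 2 ^ suc L * r ≤ 2 ^ suc L * F + n * n → r ≤ F + n
    last-block-end r r≤ = *-cancelˡ-≤ (2 ^ suc L) {{m^n≢0 2 (suc L)}} (begin
      2 ^ suc L * r                    ≤⟨ r≤ ⟩
      2 ^ suc L * F + n * n            ≤⟨ +-monoʳ-≤ (2 ^ suc L * F) (*-monoˡ-≤ n (<⇒≤ n<2^[1+L])) ⟩
      2 ^ suc L * F + 2 ^ suc L * n    ≡⟨ sym (*-distribˡ-+ (2 ^ suc L) F n) ⟩
      2 ^ suc L * (F + n)              ∎)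
      where open ≤-Reasoning

    -- `Good` persists, and halting while climbing makes the state good. An advance continues the
    -- block, opens the next one with the current residue as base, or completes block `L`, the last.
    phase-step : ∀ {t χ χ′} → Step χ χ′ → Phase t χ → Phase (suc t) χ′
    phase-step st (inj₁ good) = inj₁ (good-step st good)
    phase-step {t} {χ} {χ′} st@(halt _ _ stuck) (inj₂ cl) =
      inj₁ (good-step st (good-halted (≤-trans size≤ (begin
        block * k + pos   ≤⟨ +-mono-≤ (*-monoˡ-≤ k block≤L) (<⇒≤ pos<k) ⟩
        L * k + k         ≡⟨ +-comm (L * k) k ⟩
        suc L * k         ∎)) stuck))
      where
      open Climbing cl
      open ≤-Reasoning
    phase-step {t} {χ} {χ′} (advance s≤ r< best) (inj₂ cl) = conclude
      where
      open Climbing cl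
      open ≤-Reasoning
      r  = residue χ
      r′ = residue χ′
      r′≤r : r′ ≤ r
      r′≤r = ≤-trans (m≤n+m r′ n) (<⇒≤ r<)
      eq₁ : ∀ k p r′ → (k + suc p) * r′ ≡ k * r′ + r′ + p * r′
      eq₁ = solve-∀
      eq₂ : ∀ k p r r′ → k * r′ + r + p * r ≡ (r + k * r′) + p * r
      eq₂ = solve-∀
      eq₃ : ∀ F k p r → F + k * r + p * r ≡ F + (k + p) * r
      eq₃ = solve-∀
      -- In terms of excesses over `F`, the invariant says that the current one is at most
      -- `k / (k + pos)` times that of `base`. This weakens the geometric decay `(1 - 1/k) ^ pos`
      -- but involves no powers and still halves the excess at `pos = k`.
      residue≤′ : (k + suc pos) * r′ ≤ suc pos * F + k * base
      residue≤′ = begin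
        (k + suc pos) * r′               ≡⟨ eq₁ k pos r′ ⟩
        k * r′ + r′ + pos * r′           ≤⟨ +-mono-≤ (+-monoʳ-≤ (k * r′) r′≤r) (*-monoʳ-≤ pos r′≤r) ⟩
        k * r′ + r + pos * r             ≡⟨ eq₂ k pos r r′ ⟩
        (r + k * r′) + pos * r           ≤⟨ +-monoˡ-≤ (pos * r) (averaging χ ω r′ best) ⟩
        F + k * r + pos * r              ≡⟨ eq₃ F k pos r ⟩
        F + (k + pos) * r                ≤⟨ +-monoʳ-≤ F residue≤ ⟩
        F + (pos * F + k * base)        ≡⟨ sym (+-assoc F (pos * F) (k * base)) ⟩
        suc pos * F + k * base          ∎
      size≤′ : size χ′ ≤ block * k + suc pos
      size≤′ = ≤-trans s≤ (≤-trans (s≤s size≤) (≤-reflexive (sym (+-suc (block * k) pos))))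
      eq₄ : ∀ r′ n T → r′ + (suc n + T) ≡ suc (n + r′) + T
      eq₄ = solve-∀
      steps≤′ : r′ + suc t * suc n ≤ n * n
      steps≤′ = ≤-trans (≤-reflexive (eq₄ r′ n (t * suc n))) (≤-trans (+-monoˡ-≤ (t * suc n) r<) steps≤)
      0<k : 0 < k
      0<k = ≤-<-trans z≤n pos<k
      conclude : Phase (suc t) χ′
      conclude with suc pos <? k
      ... | yes p = inj₂ record
        { block = block ; pos = suc pos ; base = base ; block≤L = block≤L ; pos<k = p
        ; size≤ = size≤′ ; base≤ = base≤ ; residue≤ = residue≤′ ; steps≤ = steps≤′ }
      ... | no ¬p with ≤-antisym pos<k (≮⇒≥ ¬p)
      ...   | 1+pos≡k = next
        where
        base≤′ : 2 ^ suc block * r′ ≤ 2 ^ suc block * F + n * n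
        base≤′ = block-end block base r′ 0<k base≤
          (subst (λ p → (k + p) * r′ ≤ p * F + k * base) 1+pos≡k residue≤′)
        size≤″ : size χ′ ≤ suc block * k
        size≤″ = ≤-trans size≤′ (≤-reflexive (trans (cong (block * k +_) 1+pos≡k) (+-comm (block * k) k)))
        next : Phase (suc t) χ′
        next with suc block ≤? L
        ... | yes p = inj₂ record
          { block = suc block ; pos = 0 ; base = r′ ; block≤L = p ; pos<k = 0<k
          ; size≤ = ≤-trans size≤″ (m≤m+n _ 0) ; base≤ = base≤′
          ; residue≤ = ≤-reflexive (cong (_* r′) (+-identityʳ k)) ; steps≤ = steps≤′ }
        -- Blocks `0` to `L` are complete: at most `suc L * k` vertices have been chosen, and the
        -- excess is at most `n ≤ n * k`.
        ... | no ¬p = inj₁ (good-if (≤-trans size≤″ (*-monoˡ-≤ k (s≤s block≤L)))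
          (≤-trans (last-block-end r′ (subst (λ j → 2 ^ j * r′ ≤ 2 ^ j * F + n * n)
              (≤-antisym (s≤s block≤L) (≰⇒> ¬p)) base≤′))
            (+-monoʳ-≤ F (m≤m*n n k {{>-nonZero 0<k}}))))

    -- For `k = 0` there are no blocks, but then `residue-max` compares the costs directly.
    -- Otherwise block 0 starts from the initial residue, at most `n * n`.
    phase-start : ∀ {χ} → size χ ≡ 0 → Phase 0 χ
    phase-start {χ} size≡0 with k ≟ 0
    ... | yes k≡ = inj₁ (begin
      n * size χ + residue χ    ≡⟨ cong (λ s → n * s + residue χ) size≡0 ⟩
      n * 0 + residue χ         ≤⟨ +-monoʳ-≤ (n * 0) (residue-max ω χ k≡) ⟩
      n * 0 + F                 ≡⟨ cong (λ s → n * s + F) (sym k≡) ⟩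
      n * k + F                 ≤⟨ m≤n*m _ (3 * L) {{m*n≢0 3 L {{_}} {{>-nonZero 1≤L}}}} ⟩
      3 * L * (n * k + F)       ∎)
      where open ≤-Reasoning
    ... | no k≢0 = inj₂ record
      { block = 0 ; pos = 0 ; base = residue χ ; block≤L = z≤n
      ; pos<k = n≢0⇒n>0 k≢0 ; size≤ = ≤-reflexive size≡0
      ; base≤ = ≤-trans (≤-reflexive (*-identityˡ _)) (≤-trans (residue≤n² χ) (m≤n+m _ _))
      ; residue≤ = ≤-reflexive (cong (_* residue χ) (+-identityʳ k))
      ; steps≤ = ≤-trans (≤-reflexive (+-identityʳ _)) (residue≤n² χ) }

    -- Climbing through `n` rounds would have lowered the residue by at least `n * suc n`, more than
    -- the `n * n` available.
    phase-end : ∀ {χ} → Phase n χ → Good χ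
    phase-end (inj₁ good) = good
    phase-end {χ} (inj₂ cl) = ⊥-elim (<-irrefl refl (begin-strict
      n * n                      <⟨ m<n+m (n * n) 0<n ⟩
      n + n * n                  ≡⟨ sym (*-suc n n) ⟩
      n * suc n                  ≤⟨ m≤n+m _ (residue χ) ⟩
      residue χ + n * suc n      ≤⟨ Climbing.steps≤ cl ⟩
      n * n                      ∎))
      where open ≤-Reasoning

-- The program

-- The variables are numbered from the outermost loop inwards, so that a subprogram
-- preserves the variables below its first one.
vN vRound vBest vBestResidue vCand vTotal vRow vU vCount vV vHits vW : ℕ
vN           = 0
vRound       = 1
vBest        = 2
vBestResidue = 3
vCand        = 4
vTotal       = 5
vRow         = 6
vU           = 7
vCount       = 8
vV           = 9
vHits        = 10
vW           = 11

for : ℕ → Program → Program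
for x body = x ≔ lit 0 ⨾ while var x <ᵗ var vN loop (body ⨾ x ≔ var x ⊕ lit 1)

-- memberTest asks for w ∈ A ∪ {cand}; as w < n, the value cand = n yields A itself.
memberTest nearTest betterTest : Test
memberTest = lit 0 <ᵗ mem[ var vW ] ⊕ (lit 1 ⊖ ((var vW ⊖ var vCand) ⊕ (var vCand ⊖ var vW)))
nearTest   = dist[ var vRow ⊕ var vV ] <ᵈ dist[ var vRow ⊕ var vW ]
betterTest = var vTotal <ᵗ var vBestResidue

hitsBody hitsProg countProg residueProg selectProg roundProg greedy : Program
hitsBody = ifᵖ memberTest then (ifᵖ nearTest then skip else (vHits ≔ var vHits ⊕ lit 1)) else skip
hitsProg = vHits ≔ lit 0 ⨾ for vW hitsBody
countProg = vCount ≔ lit 0 ⨾ for vV (hitsProg ⨾ vCount ≔ var vCount ⊕ (lit 1 ⊖ var vHits))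
-- The machine does not multiply, so `vRow` tracks the row offset `n * u` by repeated addition.
residueProg = vTotal ≔ lit 0 ⨾ vRow ≔ lit 0 ⨾
  for vU (countProg ⨾ vTotal ≔ var vTotal ⊕ var vCount ⨾ vRow ≔ var vRow ⊕ var vN)
selectProg = for vCand (residueProg ⨾
  (ifᵖ betterTest then (vBest ≔ var vCand ⨾ vBestResidue ≔ var vTotal) else skip))
-- As vBestResidue starts at residue A ∸ n, only a candidate gaining more than n is
-- selected; without one, vBest remains n and mem[n] is not part of the output.
roundProg = vCand ≔ var vN ⨾ residueProg ⨾ vBest ≔ var vN ⨾ vBestResidue ≔ var vTotal ⊖ var vN ⨾
  selectProg ⨾ mem[ var vBest ]≔ lit 1
greedy = for vRound roundProg

-- Running time

-- An iteration takes 3 units for the test and 4 for the increment besides the body.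
loopTime : ℕ → ℕ → ℕ
loopTime n T = 2 + (n * (7 + T) + 3)

hitsTime countTime residueTime selectTime roundTime greedyTime : ℕ → ℕ
hitsTime n = 2 + loopTime n (sizeᵀ memberTest + (sizeᵀ nearTest + 4))
countTime n = 2 + loopTime n (hitsTime n + 6)
residueTime n = 2 + (2 + loopTime n (countTime n + (4 + 4)))
selectTime n = loopTime n (residueTime n + (sizeᵀ betterTest + 4))
roundTime n = 2 + (residueTime n + (2 + (4 + (selectTime n + 3))))
greedyTime n = loopTime n (roundTime n)

-- A record, so that the coefficient can be inferred by unification.
record Bound (n k T a : ℕ) : Set where
  constructor bound
  field T≤ : T ≤ a * n ^ k

module _ {n : ℕ} (0<n : 0 < n) where

  const-bound : ∀ {k} c → Bound n k c c
  const-bound {k} c = bound (m≤m*n c (n ^ k) {{m^n≢0 n k {{>-nonZero 0<n}}}})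

  +-bound : ∀ {k S T a b} → Bound n k S a → Bound n k T b → Bound n k (S + T) (a + b)
  +-bound {k} {a = a} {b} (bound S≤) (bound T≤) =
    bound (≤-trans (+-mono-≤ S≤ T≤) (≤-reflexive (sym (*-distribʳ-+ (n ^ k) a b))))

  raise-bound : ∀ {k T a} → Bound n k T a → Bound n (suc k) T a
  raise-bound {k} {a = a} (bound T≤) =
    bound (≤-trans T≤ (*-monoʳ-≤ a (m≤n*m (n ^ k) n {{>-nonZero 0<n}})))

  n*-bound : ∀ {k T a} → Bound n k T a → Bound n (suc k) (n * T) a
  n*-bound {k} {a = a} (bound T≤) = bound (≤-trans (*-monoʳ-≤ n T≤) (≤-reflexive (eq n a (n ^ k))))
    where
    eq : ∀ n a p → n * (a * p) ≡ a * (n * p)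
    eq = solve-∀

  loop-bound : ∀ {k T a} → Bound n k T a → Bound n (suc k) (loopTime n T) (2 + ((7 + a) + 3))
  loop-bound b = +-bound (const-bound 2) (+-bound (n*-bound (+-bound (const-bound 7) b)) (const-bound 3))

  hitsTime-bound : Bound n 1 (hitsTime n) _
  hitsTime-bound = +-bound (const-bound 2) (loop-bound (const-bound _))

  countTime-bound : Bound n 2 (countTime n) _
  countTime-bound = +-bound (const-bound 2) (loop-bound (+-bound hitsTime-bound (const-bound 6)))

  residueTime-bound : Bound n 3 (residueTime n) _
  residueTime-bound = +-bound (const-bound 2) (+-bound (const-bound 2)
    (loop-bound (+-bound countTime-bound (const-bound 8))))

  selectTime-bound : Bound n 4 (selectTime n) _
  selectTime-bound = loop-bound (+-bound residueTime-bound (const-bound _))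

  roundTime-bound : Bound n 4 (roundTime n) _
  roundTime-bound = +-bound (const-bound 2) (+-bound (raise-bound residueTime-bound)
    (+-bound (const-bound 2) (+-bound (const-bound 4) (+-bound selectTime-bound (const-bound 3)))))

-- The exponent counts nested loops: rounds, candidates, and the three indices of the residue. The
-- inferred coefficient stands outside the binder of `n`, so it is uniform in `n`.
greedyTime-bound : Σ[ a ∈ ℕ ] (∀ {n} → 0 < n → Bound n 5 (greedyTime n) a)
greedyTime-bound = _ , λ 0<n → loop-bound 0<n (roundTime-bound 0<n)

-- Correctness of the program

-- The sum of the two truncated differences is the distance of `w` and `c`, so the summand `1 ∸ ...`
-- is the indicator of `w ≡ c`.
member : (ℕ → ℕ) → ℕ → ℕ → Bool
member m c w = does (0 <? m w + (1 ∸ ((w ∸ c) + (c ∸ w))))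

member-self : ∀ m c → member m c c ≡ true
member-self m c = dec-true (0 <? _)
  (subst (λ d → 0 < m c + (1 ∸ d)) (sym (cong₂ _+_ (n∸n≡0 c) (n∸n≡0 c))) (m≤n+m 1 (m c)))

member-other : ∀ m {c w} → w ≢ c → member m c w ≡ does (0 <? m w)
member-other m {c} {w} w≢c with (w ∸ c) + (c ∸ w) in eq
... | zero  = ⊥-elim (w≢c (≤-antisym
  (m∸n≡0⇒m≤n (m+n≡0⇒m≡0 (w ∸ c) eq)) (m∸n≡0⇒m≤n (m+n≡0⇒n≡0 (w ∸ c) eq))))
... | suc d = cong (λ x → does (0 <? x)) (trans (cong (m w +_) (0∸n≡0 d)) (+-identityʳ (m w)))

module Verification (K : OrderedAbelianGroup) (n : ℕ) where
  open OrderedAbelianGroup K using (Carrier; _≺?_)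
  open State

  assign : ℕ → ℕ → State K → State K
  assign x a s = state (vars s [ x ↦ a ]) (mem s) (dist s)

  [↦]-same : ∀ {X : Set} (f : ℕ → X) x a → (f [ x ↦ a ]) x ≡ a
  [↦]-same f x a rewrite dec-true (x ≟ x) refl = refl

  [↦]-other : ∀ {X : Set} (f : ℕ → X) {x y} a → y ≢ x → (f [ x ↦ a ]) y ≡ f y
  [↦]-other f {x} {y} a y≢x rewrite dec-false (y ≟ x) y≢x = refl

  -- A total-correctness triple whose `T` only bounds the time from above, so that both branches of
  -- a conditional can share one bound.
  record Runs (P : Program) (s : State K) (T : ℕ) (Q : State K → Set) : Set where
    constructor runs
    field
      {final} : State K
      {time}  : ℕ
      run     : ⟨ P , s ⟩⇓[ time ] final
      time≤   : time ≤ T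
      post    : Q final

  private variable
    P P′ : Program
    s s′ : State K
    T T′ : ℕ
    Q Q′ : State K → Set

  runs-weaken : T ≤ T′ → (∀ {s} → Q s → Q′ s) → Runs P s T Q → Runs P s T′ Q′
  runs-weaken T≤ imp (runs r t≤ q) = runs r (≤-trans t≤ T≤) (imp q)

  runs-skip : Q s → Runs skip s 1 Q
  runs-skip q = runs ⇓-skip ≤-refl q

  runs-≔ : ∀ {x e} → Q (assign x (⟦ e ⟧ᴱ s) s) → Runs (x ≔ e) s (1 + sizeᴱ e) Q
  runs-≔ q = runs ⇓-var ≤-refl q

  runs-⨾ : Runs P s T Q → (∀ {s′} → Q s′ → Runs P′ s′ T′ Q′) → Runs (P ⨾ P′) s (T + T′) Q′
  runs-⨾ (runs r t≤ q) next with next q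
  ... | runs r′ t′≤ q′ = runs (⇓-seq r r′) (+-mono-≤ t≤ t′≤) q′

  runs-if : ∀ b → (⟦ b ⟧ᵀ s ≡ true → Runs P s T Q) → (⟦ b ⟧ᵀ s ≡ false → Runs P′ s T Q) →
            Runs (ifᵖ b then P else P′) s (sizeᵀ b + T) Q
  runs-if {s = s} b yes-branch no-branch with ⟦ b ⟧ᵀ s in eq
  ... | true with yes-branch refl
  ...   | runs r t≤ q = runs (⇓-then eq r) (+-monoʳ-≤ (sizeᵀ b) t≤) q
  runs-if {s = s} b yes-branch no-branch | false with no-branch refl
  ...   | runs r t≤ q = runs (⇓-else eq r) (+-monoʳ-≤ (sizeᵀ b) t≤) q

  -- The rule for counting loops, `I i` holding after `i` iterations. The counter is tracked apart
  -- from `I`, and the postcondition of the body already applies the increment, so one obligation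
  -- covers both.
  module _ (I : ℕ → State K → Set) {x : ℕ} {body : Program}
    (I⇒n : ∀ {i s} → I i s → vars s vN ≡ n)
    (I-step : ∀ {i s} → i < n → vars s x ≡ i → I i s →
              Runs body s T (λ s′ → vars s′ x ≡ i × I (suc i) (assign x (suc i) s′)))
    where

    private
      loop : Program
      loop = while var x <ᵗ var vN loop (body ⨾ x ≔ var x ⊕ lit 1)

    runs-while : ∀ r {i s} → i + r ≡ n → vars s x ≡ i → I i s →
      Runs loop s (r * (7 + T) + 3) (I n)
    runs-while zero {i} {s} i+0≡n x≡i inv = runs (⇓-stop stop) ≤-refl (subst (λ j → I j s) i≡n inv)
      where
      i≡n : i ≡ n
      i≡n = trans (sym (+-identityʳ i)) i+0≡n
      stop : does (vars s x <? vars s vN) ≡ false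
      stop = dec-false (vars s x <? vars s vN)
        (≤⇒≯ (≤-reflexive (trans (I⇒n inv) (trans (sym i≡n) (sym x≡i)))))
    runs-while (suc r) {i} {s} i+r≡n x≡i inv with I-step i<n x≡i inv
      where
      i<n : i < n
      i<n = ≤-trans (≤-reflexive (+-comm 1 i)) (≤-trans (+-monoʳ-≤ i (s≤s z≤n)) (≤-reflexive i+r≡n))
    ... | runs {s₁} run t≤ (x≡i′ , inv′) with runs-while r (trans (sym (+-suc i r)) i+r≡n) x≡′ inv″
      where
      x+1≡ : vars s₁ x + 1 ≡ suc i
      x+1≡ = trans (cong (_+ 1) x≡i′) (+-comm i 1)
      inv″ : I (suc i) (assign x (vars s₁ x + 1) s₁)
      inv″ = subst (λ a → I (suc i) (assign x a s₁)) (sym x+1≡) inv′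
      x≡′ : vars (assign x (vars s₁ x + 1) s₁) x ≡ suc i
      x≡′ = trans ([↦]-same (vars s₁) x _) x+1≡
    ...   | runs run′ t′≤ q = runs (⇓-loop go (⇓-seq run ⇓-var) run′) time≤ q
      where
      go : does (vars s x <? vars s vN) ≡ true
      go = dec-true (vars s x <? vars s vN) (subst₂ _<_ (sym x≡i) (sym (I⇒n inv))
        (≤-trans (≤-reflexive (+-comm 1 i)) (≤-trans (+-monoʳ-≤ i (s≤s z≤n)) (≤-reflexive i+r≡n))))
      eq : ∀ T r → 3 + ((T + 4) + (r * (7 + T) + 3)) ≡ suc r * (7 + T) + 3
      eq = solve-∀
      time≤ = ≤-trans (+-monoʳ-≤ 3 (+-mono-≤ (+-monoˡ-≤ 4 t≤) t′≤)) (≤-reflexive (eq T r))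

    runs-for : ∀ {s} → I 0 (assign x 0 s) → Runs (for x body) s (loopTime n T) (I n)
    runs-for {s} inv = runs-⨾ (runs-≔ {Q = λ s′ → vars s′ x ≡ 0 × I 0 s′} ([↦]-same (vars s) x 0 , inv))
      λ { (x≡0 , inv′) → runs-while n refl x≡0 inv′ }

  -- Frame conditions.

  record Frame (k : ℕ) (s s′ : State K) : Set where
    constructor frame
    field
      keeps : ∀ y {y<k : True (y <? k)} → vars s′ y ≡ vars s y
      mem≡  : mem s′ ≡ mem s
      dist≡ : dist s′ ≡ dist s
  open Frame

  -- In this and the following rules, as in `Frame` itself, side conditions of the form `True` on
  -- numerals are solved by evaluation; framing a concrete variable thus takes no explicit
  -- arithmetic.
  frame-refl : ∀ {k} → Frame k s s
  frame-refl = frame (λ _ → refl) refl refl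

  frame-trans : ∀ {k s s′ s″} → Frame k s s′ → Frame k s′ s″ → Frame k s s″
  frame-trans f g = frame (λ y {y<k} → trans (keeps g y {y<k}) (keeps f y {y<k}))
    (trans (mem≡ g) (mem≡ f)) (trans (dist≡ g) (dist≡ f))

  frame-≤ : ∀ {j k} {j≤k : True (j ≤? k)} → Frame k s s′ → Frame j s s′
  frame-≤ {j≤k = j≤k} f = frame
    (λ y {y<j} → keeps f y {fromWitness (<-≤-trans (toWitness y<j) (toWitness j≤k))})
    (mem≡ f) (dist≡ f)

  frame-assign : ∀ {k x a} {k≤x : True (k ≤? x)} → Frame k s s′ → Frame k s (assign x a s′)
  frame-assign {s′ = s′} {x = x} {a} {k≤x} f = frame
    (λ y {y<k} → trans ([↦]-other (vars s′) a (<⇒≢ (<-≤-trans (toWitness y<k) (toWitness k≤x))))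
      (keeps f y {y<k}))
    (mem≡ f) (dist≡ f)

  -- Values computed by the nested loops.

  near : (ℕ → Carrier) → ℕ → ℕ → ℕ → Bool
  near D r v w = does (D (r + v) ≺? D (r + w))

  hit : (ℕ → ℕ) → (ℕ → Carrier) → ℕ → ℕ → ℕ → ℕ → ℕ
  hit m D c r v w = bit (member m c w) * (if near D r v w then 0 else 1)

  uncoveredᴺ : (ℕ → ℕ) → (ℕ → Carrier) → ℕ → ℕ → ℕ → ℕ
  uncoveredᴺ m D c r v = 1 ∸ Σ< n (hit m D c r v)

  -- The residue after adjoining `c`, read off the raw memories; `residueᴺ≡` identifies it with
  -- `residue`.
  residueᴺ : (ℕ → ℕ) → (ℕ → Carrier) → ℕ → ℕ
  residueᴺ m D c = Σ< n λ u → Σ< n (uncoveredᴺ m D c (n * u))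

  hits-runs : ∀ s → vars s vN ≡ n → Runs hitsProg s (hitsTime n) λ s′ →
    Frame 10 s s′ × vars s′ vHits ≡ Σ< n (hit (mem s) (dist s) (vars s vCand) (vars s vRow) (vars s vV))
  hits-runs s N≡n = runs-⨾ (runs-≔ {Q = Q₀} (frame-assign frame-refl , refl)) λ { (f , h≡0) →
    runs-for I (λ { (f , _) → trans (keeps f vN) N≡n }) I-step (frame-assign f , h≡0) }
    where
    g : ℕ → ℕ
    g = hit (mem s) (dist s) (vars s vCand) (vars s vRow) (vars s vV)
    Q₀ : State K → Set
    Q₀ s′ = Frame 10 s s′ × vars s′ vHits ≡ 0
    I : ℕ → State K → Set
    I i s′ = Frame 10 s s′ × vars s′ vHits ≡ Σ< i g
    I-step : ∀ {i s′} → i < n → vars s′ vW ≡ i → I i s′ →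
      Runs hitsBody s′ (sizeᵀ memberTest + (sizeᵀ nearTest + 4))
        (λ s″ → vars s″ vW ≡ i × I (suc i) (assign vW (suc i) s″))
    I-step {i} {s′} _ w≡i (f , h≡) = runs-if memberTest
      (λ isMember → runs-if nearTest
        (λ isNear → runs-weaken (s≤s z≤n) (λ q → q)
          (runs-skip (w≡i , frame-assign f , add {0} (hit≡ isMember isNear) (sym (+-identityʳ _)))))
        (λ isFar → runs-≔ (w≡i , frame-assign (frame-assign f) , add {1} (hit≡ isMember isFar) refl)))
      (λ notMember → runs-weaken (s≤s z≤n) (λ q → q)
        (runs-skip (w≡i , frame-assign f , add {0}
          (cong (λ b → bit b * (if near (dist s) (vars s vRow) (vars s vV) i then 0 else 1))
            (trans (sym member≡) notMember)) (sym (+-identityʳ _)))))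
      where
      member≡ : ⟦ memberTest ⟧ᵀ s′ ≡ member (mem s) (vars s vCand) i
      member≡ = trans (cong₂ (λ m c → member m c (vars s′ vW)) (mem≡ f) (keeps f vCand))
        (cong (member (mem s) (vars s vCand)) w≡i)
      near≡ : ⟦ nearTest ⟧ᵀ s′ ≡ near (dist s) (vars s vRow) (vars s vV) i
      near≡ rewrite dist≡ f | keeps f vRow {_} | keeps f vV {_} | w≡i = refl
      hit≡ : ∀ {b b′} → ⟦ memberTest ⟧ᵀ s′ ≡ b → ⟦ nearTest ⟧ᵀ s′ ≡ b′ →
        g i ≡ bit b * (if b′ then 0 else 1)
      hit≡ p q = cong₂ (λ b b′ → bit b * (if b′ then 0 else 1))
        (trans (sym member≡) p) (trans (sym near≡) q)
      add : ∀ {d a} → g i ≡ d → a ≡ vars s′ vHits + d → a ≡ Σ< (suc i) g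
      add g≡ a≡ = trans a≡ (trans (cong₂ _+_ h≡ (sym g≡)) (sym (Σ<-suc i g)))

  count-runs : ∀ s → vars s vN ≡ n → Runs countProg s (countTime n) λ s′ →
    Frame 8 s s′ × vars s′ vCount ≡ Σ< n (uncoveredᴺ (mem s) (dist s) (vars s vCand) (vars s vRow))
  count-runs s N≡n = runs-⨾ (runs-≔ {Q = Q₀} (frame-assign frame-refl , refl)) λ { (f , c≡0) →
    runs-for I (λ { (f , _) → trans (keeps f vN) N≡n }) I-step (frame-assign f , c≡0) }
    where
    g : ℕ → ℕ
    g = uncoveredᴺ (mem s) (dist s) (vars s vCand) (vars s vRow)
    Q₀ : State K → Set
    Q₀ s′ = Frame 8 s s′ × vars s′ vCount ≡ 0
    I : ℕ → State K → Set
    I i s′ = Frame 8 s s′ × vars s′ vCount ≡ Σ< i g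
    I-step : ∀ {i s′} → i < n → vars s′ vV ≡ i → I i s′ →
      Runs (hitsProg ⨾ vCount ≔ var vCount ⊕ (lit 1 ⊖ var vHits)) s′ (hitsTime n + 6)
        (λ s″ → vars s″ vV ≡ i × I (suc i) (assign vV (suc i) s″))
    I-step {i} {s′} _ v≡i (f , c≡) =
      runs-⨾ (hits-runs s′ (trans (keeps f vN) N≡n)) λ { (f′ , h≡) → runs-≔
      ( trans (keeps f′ vV) v≡i
      , frame-assign (frame-assign (frame-trans f (frame-≤ f′)))
      , trans (cong₂ (λ c h → c + (1 ∸ h)) (trans (keeps f′ vCount) c≡) (trans h≡ hits≡))
          (sym (Σ<-suc i g))) }
      where
      hits≡ : Σ< n (hit (mem s′) (dist s′) (vars s′ vCand) (vars s′ vRow) (vars s′ vV))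
            ≡ Σ< n (hit (mem s) (dist s) (vars s vCand) (vars s vRow) i)
      hits≡ rewrite mem≡ f | dist≡ f | keeps f vCand {_} | keeps f vRow {_} | v≡i = refl

  residue-runs : ∀ s → vars s vN ≡ n → Runs residueProg s (residueTime n) λ s′ →
    Frame 5 s s′ × vars s′ vTotal ≡ residueᴺ (mem s) (dist s) (vars s vCand)
  residue-runs s N≡n = runs-⨾ (runs-≔ {Q = Q₀} (frame-assign frame-refl , refl)) λ { {s₁} (f , t≡0) →
    runs-⨾ (runs-≔ {Q = Q₁} (frame-assign f , t≡0 , refl)) λ { (f , t≡0 , r≡0) →
    runs-weaken ≤-refl (λ { (f , t≡ , _) → f , t≡ })
      (runs-for I (λ { (f , _) → trans (keeps f vN) N≡n }) I-step
        (frame-assign f , t≡0 , trans r≡0 (sym (*-zeroʳ n)))) } }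
    where
    g : ℕ → ℕ
    g u = Σ< n (uncoveredᴺ (mem s) (dist s) (vars s vCand) (n * u))
    Q₀ Q₁ : State K → Set
    Q₀ s′ = Frame 5 s s′ × vars s′ vTotal ≡ 0
    Q₁ s′ = Frame 5 s s′ × vars s′ vTotal ≡ 0 × vars s′ vRow ≡ 0
    I : ℕ → State K → Set
    I i s′ = Frame 5 s s′ × vars s′ vTotal ≡ Σ< i g × vars s′ vRow ≡ n * i
    Q₂ : ℕ → State K → Set
    Q₂ i s′ = Frame 5 s s′ × vars s′ vTotal ≡ Σ< (suc i) g × vars s′ vRow ≡ n * i × vars s′ vU ≡ i
    I-step : ∀ {i s′} → i < n → vars s′ vU ≡ i → I i s′ →
      Runs (countProg ⨾ vTotal ≔ var vTotal ⊕ var vCount ⨾ vRow ≔ var vRow ⊕ var vN) s′ (countTime n + (4 + 4))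
        (λ s″ → vars s″ vU ≡ i × I (suc i) (assign vU (suc i) s″))
    I-step {i} {s′} _ u≡i (f , t≡ , r≡) =
      runs-⨾ (count-runs s′ (trans (keeps f vN) N≡n)) λ { (f′ , c≡) →
      runs-⨾ (runs-≔ {Q = Q₂ i}
        ( frame-assign (frame-trans f (frame-≤ f′))
        , trans (cong₂ _+_ (trans (keeps f′ vTotal) t≡) (trans c≡ count≡))
            (sym (Σ<-suc i g))
        , trans (keeps f′ vRow) r≡
        , trans (keeps f′ vU) u≡i)) λ { (f″ , t≡′ , r≡′ , u≡′) →
      runs-≔ (u≡′ , frame-assign (frame-assign f″) , t≡′
        , trans (cong₂ _+_ r≡′ (trans (keeps f″ vN) N≡n)) (trans (+-comm (n * i) n) (sym (*-suc n i)))) } }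
      where
      count≡ : Σ< n (uncoveredᴺ (mem s′) (dist s′) (vars s′ vCand) (vars s′ vRow)) ≡ g i
      count≡ rewrite mem≡ f | dist≡ f | keeps f vCand {_} | r≡ = refl

  -- The invariant of the minimum search over the candidates below `i`: `x` is the minimum of their
  -- residues and the threshold `r n ∸ n`. `origin` separates the sentinel `n` from a real candidate
  -- that beats the threshold.
  record Selected (r : ℕ → ℕ) (i b x : ℕ) : Set where
    constructor selected
    field
      minimal : ∀ c → c < i → x ≤ r c
      below   : x ≤ r n ∸ n
      origin  : (b ≡ n × x ≡ r n ∸ n) ⊎ (b < n × x ≡ r b × x < r n ∸ n)

  RoundResult : State K → State K → Set
  RoundResult s s′ = vars s′ vN ≡ vars s vN × vars s′ vRound ≡ vars s vRound × dist s′ ≡ dist s ×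
    Σ[ b ∈ ℕ ] Σ[ x ∈ ℕ ] (Selected (residueᴺ (mem s) (dist s)) n b x × mem s′ ≡ mem s [ b ↦ 1 ])

  round-runs : ∀ s → vars s vN ≡ n → Runs roundProg s (roundTime n) (RoundResult s)
  round-runs s N≡n =
    runs-⨾ (runs-≔ {Q = Q₀} (frame-assign frame-refl , N≡n)) λ { (f , c≡) →
    runs-⨾ (runs-weaken ≤-refl (λ { (f′ , t≡) → frame-trans f (frame-≤ f′) , trans t≡ (residue≡ f c≡) })
      (residue-runs _ (trans (keeps f vN) N≡n))) λ { {s₂} (f , t≡) →
    runs-⨾ (runs-≔ {Q = Q₁} (frame-assign f , t≡ , trans (keeps f vN) N≡n)) λ { (f , t≡ , b≡) →
    runs-⨾ (runs-≔ {Q = Q₂} (frame-assign f , cong₂ _∸_ t≡ (trans (keeps f vN) N≡n) , b≡)) λ { (f , x≡ , b≡) →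
    runs-⨾ (runs-for I (λ { (f , _) → trans (keeps f vN) N≡n }) I-step
      (frame-assign f , selected (λ _ ()) (≤-reflexive x≡) (inj₁ (b≡ , x≡)))) λ { {s₅} (f , sel) →
    runs ⇓-mem ≤-refl
      ( keeps f vN , keeps f vRound , dist≡ f , vars s₅ vBest , vars s₅ vBestResidue , sel
      , cong (_[ vars s₅ vBest ↦ 1 ]) (mem≡ f)) } } } } }
    where
    r : ℕ → ℕ
    r = residueᴺ (mem s) (dist s)
    Q₀ Q₁ Q₂ : State K → Set
    Q₀ s′ = Frame 2 s s′ × vars s′ vCand ≡ n
    Q₁ s′ = Frame 2 s s′ × vars s′ vTotal ≡ r n × vars s′ vBest ≡ n
    Q₂ s′ = Frame 2 s s′ × vars s′ vBestResidue ≡ r n ∸ n × vars s′ vBest ≡ n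
    residue≡ : ∀ {s′ c} → Frame 2 s s′ → vars s′ vCand ≡ c → residueᴺ (mem s′) (dist s′) (vars s′ vCand) ≡ r c
    residue≡ f refl rewrite mem≡ f | dist≡ f = refl
    I : ℕ → State K → Set
    I i s′ = Frame 2 s s′ × Selected r i (vars s′ vBest) (vars s′ vBestResidue)
    bound-suc : ∀ {i x} → (∀ c → c < i → x ≤ r c) → x ≤ r i → ∀ c → c < suc i → x ≤ r c
    bound-suc below-i at-i c c<1+i with m≤n⇒m<n∨m≡n (s≤s⁻¹ c<1+i)
    ... | inj₁ c<i  = below-i c c<i
    ... | inj₂ refl = at-i
    I-step : ∀ {i s′} → i < n → vars s′ vCand ≡ i → I i s′ →
      Runs _ s′ (residueTime n + (sizeᵀ betterTest + 4))
        (λ s″ → vars s″ vCand ≡ i × I (suc i) (assign vCand (suc i) s″))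
    I-step {i} {s′} i<n c≡i (f , selected minimal below origin) =
      runs-⨾ (residue-runs s′ (trans (keeps f vN) N≡n)) λ { {s₁} (f′ , t≡) →
      let t≡′ = trans t≡ (residue≡ f c≡i)
          x≡′ = keeps f′ vBestResidue
          f″  = frame-trans f (frame-≤ f′)
          c≡′ = trans (keeps f′ vCand) c≡i
      in runs-if betterTest
        (λ better →
          let r<x = subst₂ _<_ t≡′ x≡′ (does-true⇒ (_ <? _) better)
              r<  = <-≤-trans r<x below
          in runs-⨾
               (runs-≔ {Q = λ s₂ → Frame 2 s s₂ × vars s₂ vBest ≡ i × vars s₂ vCand ≡ i × vars s₂ vTotal ≡ r i}
               (frame-assign f″ , c≡′ , c≡′ , t≡′)) λ { (f , b≡ , c≡ , t≡) →
             runs-≔ (c≡ , frame-assign (frame-assign f)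
               , subst₂ (Selected r (suc i)) (sym b≡) (sym t≡) (selected
                   (bound-suc (λ c c<i → ≤-trans (<⇒≤ r<x) (minimal c c<i)) ≤-refl)
                   (<⇒≤ r<) (inj₂ (i<n , refl , r<)))) })
        (λ worse → runs-weaken (s≤s z≤n) (λ q → q) (runs-skip (c≡′ , frame-assign f″
          , subst₂ (Selected r (suc i)) (sym (keeps f′ vBest)) (sym x≡′) (selected
              (bound-suc minimal (≮⇒≥ (λ r<x → does-false⇒ (_ <? _) worse
                (subst₂ _<_ (sym t≡′) (sym x≡′) r<x))))
              below origin)))) }
      where
      does-true⇒ : ∀ {A : Set} (d : Dec A) → does d ≡ true → A
      does-true⇒ (yes a) _ = a
      does-false⇒ : ∀ {A : Set} (d : Dec A) → does d ≡ false → ¬ A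
      does-false⇒ (no ¬a) _ = ¬a

-- Reduction to covering

∣tabulate∣ : ∀ {n} (p : Fin n → Bool) → ∣ tabulate p ∣ ≡ ∑[ i < n ] bit (p i)
∣tabulate∣ {zero}  p = refl
∣tabulate∣ {suc n} p with p zero
... | true  = cong suc (∣tabulate∣ (p ∘ suc))
... | false = ∣tabulate∣ (p ∘ suc)

module Link {K : OrderedAbelianGroup} {n : ℕ} (M : FiniteMetric K n) where
  open OrderedAbelianGroup K
  open FiniteMetric M
  open Verification K n
  open State

  D : ℕ → Carrier
  D = inputDist M

  inputDist-toℕ : ∀ u v → D (n * toℕ u + toℕ v) ≡ d u v
  inputDist-toℕ u v rewrite sym (Fin.toℕ-combine u v) with toℕ (combine u v) <? n * n
  ... | yes p = cong (uncurry d) (trans (cong (remQuot n) (Fin.fromℕ<-toℕ (combine u v) p))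
    (Fin.remQuot-combine u v))
  ... | no ¬p = ⊥-elim (¬p (Fin.toℕ<n (combine u v)))

  covers : Fin n → Fin n → Fin n → ℕ
  covers u v w = if does (d u v ≺? d u w) then 0 else 1

  open Greedy covers

  χ : (ℕ → ℕ) → Fin n → Bool
  χ m w = does (0 <? m (toℕ w))

  residueᴺ≡ : ∀ m c {ψ} → (∀ w → member m c (toℕ w) ≡ ψ w) → residueᴺ m D c ≡ residue ψ
  residueᴺ≡ m c eq = sum-cong-≗ λ u → sum-cong-≗ λ v → cong (1 ∸_) (sum-cong-≗ λ w →
    cong₂ (λ b b′ → bit b * (if b′ then 0 else 1)) (eq w) (cong₂ (λ x y → does (x ≺? y))
      (inputDist-toℕ u v) (inputDist-toℕ u w)))

  member-n : ∀ m w → member m n (toℕ w) ≡ χ m w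
  member-n m w = member-other m (<⇒≢ (Fin.toℕ<n w))

  member-toℕ : ∀ m c w → member m (toℕ c) (toℕ w) ≡ adjoin (χ m) c w
  member-toℕ m c w with w Fin.≟ c
  ... | yes refl = trans (member-self m (toℕ w)) (sym (∨-zeroʳ (χ m w)))
  ... | no w≢c   = trans (member-other m (w≢c ∘ Fin.toℕ-injective)) (sym (∨-identityʳ (χ m w)))

  χ-update : ∀ m c w → χ (m [ toℕ c ↦ 1 ]) w ≡ adjoin (χ m) c w
  χ-update m c w with w Fin.≟ c
  ... | yes refl = trans (cong (λ x → does (0 <? x)) ([↦]-same m (toℕ w) 1))
    (sym (∨-zeroʳ (χ m w)))
  ... | no w≢c   = trans (cong (λ x → does (0 <? x)) ([↦]-other m 1 (w≢c ∘ Fin.toℕ-injective)))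
    (sym (∨-identityʳ (χ m w)))

  χ-update-n : ∀ m w → χ (m [ n ↦ 1 ]) w ≡ χ m w
  χ-update-n m w = cong (λ x → does (0 <? x)) ([↦]-other m 1 (<⇒≢ (Fin.toℕ<n w)))

  size-adjoin : ∀ ψ c → size (adjoin ψ c) ≤ suc (size ψ)
  size-adjoin ψ c = sum-adjust-≤ c
    (λ w w≢c → ≤-reflexive (cong bit (trans
      (cong (ψ w ∨_) (dec-false (w Fin.≟ c) w≢c)) (∨-identityʳ (ψ w)))))
    (≤-trans (bit≤1 (adjoin ψ c c)) (s≤s z≤n))

  -- The sentinel becomes `halt` and a real candidate `advance`; in both cases minimality of `x`
  -- supplies the condition on all vertices.
  selected-step : ∀ m {b x} → Selected (residueᴺ m D) n b x → Step (χ m) (χ (m [ b ↦ 1 ]))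
  selected-step m {b} {x} (selected minimal below origin) = go origin
    where
    r : ℕ → ℕ
    r = residueᴺ m D
    r-n : r n ≡ residue (χ m)
    r-n = residueᴺ≡ m n (member-n m)
    x≤ : ∀ c → x ≤ residue (adjoin (χ m) c)
    x≤ c = ≤-trans (minimal (toℕ c) (Fin.toℕ<n c)) (≤-reflexive (residueᴺ≡ m (toℕ c) (member-toℕ m c)))
    go : (b ≡ n × x ≡ r n ∸ n) ⊎ (b < n × x ≡ r b × x < r n ∸ n) → Step (χ m) (χ (m [ b ↦ 1 ]))
    go (inj₁ (refl , refl)) =
      halt (≤-reflexive (size-cong (χ-update-n m))) (≤-reflexive (residue-cong (χ-update-n m)))
      λ c → ≤-trans (m≤n+m∸n (residue (χ m)) n)
        (+-monoʳ-≤ n (≤-trans (≤-reflexive (cong (_∸ n) (sym r-n))) (x≤ c)))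
    go (inj₂ (b<n , x≡ , x<)) = 
      subst (λ b → Step (χ m) (χ (m [ b ↦ 1 ]))) (Fin.toℕ-fromℕ< b<n) (advance
      (≤-trans (≤-reflexive (size-cong (χ-update m c))) (size-adjoin (χ m) c))
      -- As `x < r n ∸ n`, the difference is nonzero and hence not truncated, which gives
      -- `n + x < r n`.
      (subst₂ (λ y z → n + y < z) x≡residue r-n (≤-trans (≤-reflexive (cong suc (+-comm n x)))
        (m≤o∸n⇒m+n≤o (suc x) (<⇒≤ (m∸n≢0⇒n<m (≢-sym (<⇒≢ (≤-<-trans z≤n x<))))) x<)))
      (λ c′ → subst (_≤ residue (adjoin (χ m) c′)) x≡residue (x≤ c′)))
      where
      c : Fin n
      c = fromℕ< b<n
      x≡residue : x ≡ residue (χ (m [ toℕ c ↦ 1 ]))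
      x≡residue = trans x≡ (trans (cong r (sym (Fin.toℕ-fromℕ< b<n)))
        (trans (residueᴺ≡ m (toℕ c) (member-toℕ m c)) (sym (residue-cong (χ-update m c)))))

  -- Minimum distances and the cost as a covering objective.

  private module S⁺ = StrictTotalOrder strictTotalOrder⁺

  ≺⁺min⇒ : ∀ {x : Carrier⁺} {xs} → x S⁺.< min⁺ Sup.⊤⁺ xs → All (x S⁺.<_) xs
  ≺⁺min⇒ {x} {xs} x<min = All.map trans-≤
    (Extrema.min≤xs (STO.totalOrder strictTotalOrder⁺) Sup.⊤⁺ xs)
    where
    trans-≤ : ∀ {y} → (min⁺ Sup.⊤⁺ xs S⁺.< y) ⊎ (min⁺ Sup.⊤⁺ xs S⁺.≈ y) → x S⁺.< y
    trans-≤ (inj₁ m<y) = S⁺.trans x<min m<y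
    trans-≤ (inj₂ m≈y) = proj₁ S⁺.<-resp-≈ m≈y x<min

  -- The left side is finite, so it also lies below the start value ∞; this includes the empty list.
  ≺⁺min⇐ : ∀ {a xs} → All (Sup.[ a ] S⁺.<_) xs → Sup.[ a ] S⁺.< min⁺ Sup.⊤⁺ xs
  ≺⁺min⇐ = Extrema.argmin-all (STO.totalOrder strictTotalOrder⁺) id Supremum.[ _ ]<⊤⁺

  ≺minDist⇒ : ∀ {u v A} → Sup.[ d u v ] S⁺.< minDist M u A → ∀ {w} → w ∈ A → d u v ≺ d u w
  ≺minDist⇒ {u} {v} {A} lt {w} w∈A = Supremum.[<]-injective _≺_ (All.lookup (≺⁺min⇒ lt)
    (∈-map⁺ (λ w → Sup.[ d u w ]) (∈-filter⁺ (_∈? A) (∈-allFin w) w∈A)))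

  ≺minDist⇐ : ∀ {u v A} → (∀ {w} → w ∈ A → d u v ≺ d u w) → Sup.[ d u v ] S⁺.< minDist M u A
  ≺minDist⇐ {u} {v} {A} near = ≺⁺min⇐ (All.map⁺ (All.tabulate λ w∈ →
    Supremum.[ near (proj₂ (∈-filter⁻ (_∈? A) {xs = allFin n} w∈)) ]))

  ∈tabulate⇒ : ∀ {ψ : Fin n → Bool} {w} → w ∈ tabulate ψ → ψ w ≡ true
  ∈tabulate⇒ {ψ} {w} w∈ = trans (sym (lookup∘tabulate ψ w)) ([]=⇒lookup w∈)

  ∈tabulate⇐ : ∀ {ψ : Fin n → Bool} {w} → ψ w ≡ true → w ∈ tabulate ψ
  ∈tabulate⇐ {ψ} {w} ψw = lookup⇒[]= w (tabulate ψ) (trans (lookup∘tabulate ψ w) ψw)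

  does-∈tabulate : ∀ ψ w → does (w ∈? tabulate ψ) ≡ ψ w
  does-∈tabulate ψ w with ψ w in eq
  ... | true  = dec-true (w ∈? tabulate ψ) (∈tabulate⇐ eq)
  ... | false = dec-false (w ∈? tabulate ψ) (λ w∈ → true≢false (trans (sym (∈tabulate⇒ w∈)) eq))
    where
    true≢false : true ≢ false
    true≢false ()

  -- Being closer than the minimum distance to a set means being closer than each of its elements,
  -- that is, having no hit.
  uncovered≡ : ∀ ψ u v → bit (does (Sup.[ d u v ] ≺⁺? minDist M u (tabulate ψ))) ≡ uncovered ψ u v
  uncovered≡ ψ u v with Sup.[ d u v ] ≺⁺? minDist M u (tabulate ψ)
  ... | yes lt = cong (1 ∸_) (sym (sum-zero hit≡0))
    where
    hit≡0 : ∀ w → bit (ψ w) * covers u v w ≡ 0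
    hit≡0 w with ψ w in eq
    ... | false = refl
    ... | true  = cong (λ b → 1 * (if b then 0 else 1))
      (dec-true (d u v ≺? d u w) (≺minDist⇒ lt (∈tabulate⇐ eq)))
  ... | no ¬lt = sym (m≤n⇒m∸n≡0 (n≢0⇒n>0 λ hits≡0 → ¬lt (≺minDist⇐ λ w∈ → closer hits≡0 w∈)))
    where
    closer : hits ψ u v ≡ 0 → ∀ {w} → w ∈ tabulate ψ → d u v ≺ d u w
    -- The vanishing term of `hits` is abstracted together with the comparison, so that
    -- `covers u v w` reduces in it. For a member `w` that is not farther than `v` the term would be
    -- 1.
    closer hits≡0 {w} w∈ with d u v ≺? d u w
      | n≤0⇒n≡0 (≤-trans (term≤sum (λ w → bit (ψ w) * covers u v w) w) (≤-reflexive hits≡0))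
    ... | yes p | _ = p
    ... | no _  | eq with trans (cong (λ b → bit b * 1) (sym (∈tabulate⇒ w∈))) eq
    ...   | ()

  ∣R₁∣ : ∀ ψ u → ∣ R M (tabulate ψ) 1 u ∣ ≡ ∑[ v < n ] uncovered ψ u v
  ∣R₁∣ ψ u = trans
    (∣tabulate∣ λ v → does ((v ∈? ⊤) ×-dec (Sup.[ d u v ] ≺⁺? minDist M u (tabulate ψ))))
    (sum-cong-≗ λ v → trans
      (cong (λ b → bit (b ∧ does (Sup.[ d u v ] ≺⁺? minDist M u (tabulate ψ))))
      (dec-true (v ∈? ⊤) ∈⊤))
      (uncovered≡ ψ u v))

  -- The distance to the empty set `A₂` is ∞, so every element of `A₁` qualifies.
  ∣R₂∣ : ∀ ψ u → ∣ R M (tabulate ψ) 2 u ∣ ≡ size ψ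
  ∣R₂∣ ψ u = trans (∣tabulate∣ λ v → does ((v ∈? tabulate ψ) ×-dec (Sup.[ d u v ] ≺⁺? minDist M u ⊥)))
    (sum-cong-≗ λ v → cong bit (trans (cong₂ _∧_ (does-∈tabulate ψ v)
      (dec-true (Sup.[ d u v ] ≺⁺? minDist M u ⊥) (≺minDist⇐ λ w∈⊥ → ⊥-elim (∉⊥ w∈⊥)))) (∧-identityʳ (ψ v))))

  cost≡ : ∀ ψ → cost M (tabulate ψ) ≡ n * size ψ + residue ψ
  cost≡ ψ = begin
    cost M (tabulate ψ)
      ≡⟨ sum-list {n = n} (λ u → ∣ R M (tabulate ψ) 1 u ∣ + (∣ R M (tabulate ψ) 2 u ∣ + 0)) id ⟩
    ∑[ u < n ] (∣ R M (tabulate ψ) 1 u ∣ + (∣ R M (tabulate ψ) 2 u ∣ + 0))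
      ≡⟨ sum-cong-≗ (λ u → cong₂ _+_ (∣R₁∣ ψ u) (trans (+-identityʳ _) (∣R₂∣ ψ u))) ⟩
    ∑[ u < n ] (∑[ v < n ] uncovered ψ u v + size ψ)
      ≡⟨ ∑-distrib-+ (λ u → ∑[ v < n ] uncovered ψ u v) (λ _ → size ψ) ⟩
    residue ψ + ∑[ u < n ] size ψ
      ≡⟨ cong (residue ψ +_) (sum-const n (size ψ)) ⟩
    residue ψ + n * size ψ
      ≡⟨ +-comm (residue ψ) _ ⟩
    n * size ψ + residue ψ ∎
    where open ≡-Reasoning

  -- A list minimum is attained, here at the start value `cost ⊤` or at a listed set. The attaining
  -- set is the competitor `ω` of the analysis.
  optimum : ∃ λ A → optimalCost M ≡ cost M A
  optimum = [ (λ eq → ⊤ , eq) , (λ p → let A , _ , eq = ∈-map⁻ (cost M) p in A , eq) ]′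
    (ExtremaNat.argmin-sel id (cost M ⊤) (map (cost M) (subsets n)))

  -- `Phase` is the invariant of the outer loop; it starts from the empty set because the memory is
  -- zero. The hypothesis `2 ≤ n` enters the analysis as `1 ≤ ⌊log₂ n ⌋` and `0 < n`.
  approximation : 2 ≤ n → Runs greedy (initial M) (greedyTime n) λ s →
    cost M (output n s) ≤ 3 * ⌊log₂ n ⌋ * optimalCost M
  approximation 2≤n = runs-weaken ≤-refl (λ { {s} (_ , _ , phase) → conclude s phase })
    (runs-for I proj₁ I-step (refl , refl , phase-start (sum-zero {n} λ _ → refl)))
    where
    ω : Fin n → Bool
    ω = lookup (proj₁ optimum)
    open Analysis ω ⌊log₂ n ⌋ (⌊log₂⌋-mono-≤ 2≤n) (n<2^[1+⌊log₂n⌋] n) (≤-trans (s≤s z≤n) 2≤n)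
    I : ℕ → State K → Set
    I t s = vars s vN ≡ n × dist s ≡ D × Phase t (χ (mem s))
    I-step : ∀ {t s} → t < n → vars s vRound ≡ t → I t s →
      Runs roundProg s (roundTime n) (λ s′ → vars s′ vRound ≡ t × I (suc t) (assign vRound (suc t) s′))
    I-step {t} {s} _ round≡t (N≡n , dist≡ , phase) = runs-weaken ≤-refl
      (λ { (N≡ , round≡ , dist≡′ , b , x , sel , mem≡) →
        trans round≡ round≡t , trans N≡ N≡n , trans dist≡′ dist≡
        , phase-step (subst (λ m → Step (χ (mem s)) (χ m)) (sym mem≡)
            (selected-step (mem s) (subst (λ D → Selected (residueᴺ (mem s) D) n b x) dist≡ sel))) phase })
      (round-runs s N≡n)
    conclude : ∀ s → Phase n (χ (mem s)) → cost M (output n s) ≤ 3 * ⌊log₂ n ⌋ * optimalCost M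
    conclude s phase = begin
      cost M (output n s)                               ≡⟨ cost≡ (χ (mem s)) ⟩
      n * size (χ (mem s)) + residue (χ (mem s))        ≤⟨ phase-end phase ⟩
      3 * ⌊log₂ n ⌋ * (n * size ω + residue ω)          ≡⟨ cong (3 * ⌊log₂ n ⌋ *_) (sym (cost≡ ω)) ⟩
      3 * ⌊log₂ n ⌋ * cost M (tabulate ω)               ≡⟨ cong (λ A → 3 * ⌊log₂ n ⌋ * cost M A) (tabulate∘lookup _) ⟩
      3 * ⌊log₂ n ⌋ * cost M (proj₁ optimum)            ≡⟨ cong (3 * ⌊log₂ n ⌋ *_) (sym (proj₂ optimum)) ⟩
      3 * ⌊log₂ n ⌋ * optimalCost M                     ∎
      where open ≤-Reasoning

theorem2p4 : Σ[ C ∈ ℕ ] (0 < C × (Σ[ P ∈ Program ] Σ[ a ∈ ℕ ] Σ[ k ∈ ℕ ]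
    ((K : OrderedAbelianGroup) (n : ℕ) → 2 ≤ n → (M : FiniteMetric K n) →
    Σ[ A₁ ∈ Subset n ] Σ[ t ∈ ℕ ]
    (P On M Outputs A₁ After t
    × t ≤ a * n ^ k
    × cost M A₁ ≤ C * ⌊log₂ n ⌋ * optimalCost M))))
theorem2p4 = 3 , s≤s z≤n , greedy , proj₁ greedyTime-bound , 5 , λ K n 2≤n M →
  let open Verification.Runs (Link.approximation M 2≤n)
  in output n final , time , (final , run , refl)
     , ≤-trans time≤ (Bound.T≤ (proj₂ greedyTime-bound (≤-trans (s≤s z≤n) 2≤n))) , post
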